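{- The following problem is decidable: given an entailment $\Pi\land\Sigma\vdash\{\exists\vec{y_i}(\Pi_i\land\Sigma_i)\}_{i\in I}$ of the symbolic-heap system with arrays (with $I$ finite) such that every array atomic formula occurring in each $\Sigma_i$ has the form $\mathrm{Arr}(t,t+u)$ where the term $u$ contains no variable of $\vec{y_i}$, decide whether it is valid, i.e. whether for all stores $s$ and heaps $h$, $s,h\models\Pi\land\Sigma$ implies $s,h\models\exists\vec{y_i}(\Pi_i\land\Sigma_i)$ for some $i\in I$.
   Context: Terms: $t::=x\mid 0\mid 1\mid 2\mid\cdots\mid t+t$ over variables $x$, interpreted in $N$. A store $s$ maps variables to $N$, extended to terms by $s(n)=n$, $s(t+u)=s(t)+s(u)$. A heap is a finite partial function $h$ from $N\setminus\{0\}$ to $N$. Pure formulas $\Pi$ are formulas of Presburger arithmetic (built from $t=t$, $\land$, $\neg$, $\exists$). Spatial formulas: $\Sigma::=\mathrm{Emp}\mid t\mapsto u\mid\mathrm{Arr}(t,u)\mid\Sigma*\Sigma$. Satisfaction: pure formulas hold iff true under $s$; $s,h\models\mathrm{Emp}$ iff $\mathrm{Dom}(h)=\emptyset$; $s,h\models t\mapsto u$ iff $\mathrm{Dom}(h)=\{s(t)\}$ and $h(s(t))=s(u)$; $s,h\models\mathrm{Arr}(t,u)$ iff $s(t)\le s(u)$ and $\mathrm{Dom}(h)=\{x\mid s(t)\le x\le s(u)\}$; $s,h\models F_1*F_2$ iff $h$ is the disjoint union of $h_1,h_2$ with $s,h_1\models F_1$, $s,h_2\models F_2$; $\land$ and $\exists$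 classical (for $\exists x$, the store is updated at $x$). -}

module Defs where

open import Data.Nat using (ℕ; zero; suc; _+_; _≤_; _≡ᵇ_)
open import Data.Bool using (if_then_else_)
open import Data.Maybe using (Maybe; just; nothing)
open import Data.Product using (Σ; _×_; _,_; ∃)
open import Data.Unit using (⊤)
open import Data.List using (List; []; _∷_)
open import Data.List.Membership.Propositional using (_∈_; _∉_)
open import Relation.Nullary using (¬_)
open import Relation.Binary.PropositionalEquality using (_≡_)

Var : Set
Var = ℕ

data Term : Set where
  var : Var → Term
  lit : ℕ → Term
  _⊕_ : Term → Term → Term

data Pure : Set where
  _≐_  : Term → Term → Pure
  _∧ₚ_ : Pure → Pure → Pure
  ¬ₚ_  : Pure → Pure
  ∃ₚ   : Var → Pure → Pure

data Spatial : Set where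
  emp  : Spatial
  _↦_  : Term → Term → Spatial
  arr  : Term → Term → Spatial
  _✶_  : Spatial → Spatial → Spatial

Store : Set
Store = Var → ℕ

_[_≔_] : Store → Var → ℕ → Store
(s [ x ≔ n ]) y = if y ≡ᵇ x then n else s y

⟦_⟧ₜ : Term → Store → ℕ
⟦ var x ⟧ₜ s = s x
⟦ lit n ⟧ₜ s = n
⟦ t ⊕ u ⟧ₜ s = ⟦ t ⟧ₜ s + ⟦ u ⟧ₜ s

record Heap : Set where
  field
    fun    : ℕ → Maybe ℕ
    zero∉  : fun 0 ≡ nothing
    finite : Σ ℕ λ b → ∀ x → b ≤ x → fun x ≡ nothing
open Heap public

_∈Dom_ : ℕ → Heap → Set
x ∈Dom h = ∃ λ v → fun h x ≡ just v

DisjUnion : Heap → Heap → Heap → Set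
DisjUnion h h₁ h₂ = ∀ x →
  (fun h₁ x ≡ nothing × fun h x ≡ fun h₂ x) Data.Sum.⊎
  (fun h₂ x ≡ nothing × fun h x ≡ fun h₁ x)
  where import Data.Sum

_⊨ₚ_ : Store → Pure → Set
s ⊨ₚ (t ≐ u)  = ⟦ t ⟧ₜ s ≡ ⟦ u ⟧ₜ s
s ⊨ₚ (φ ∧ₚ ψ) = (s ⊨ₚ φ) × (s ⊨ₚ ψ)
s ⊨ₚ (¬ₚ φ)   = ¬ (s ⊨ₚ φ)
s ⊨ₚ (∃ₚ x φ) = Σ ℕ λ n → (s [ x ≔ n ]) ⊨ₚ φ

Sat : Store → Heap → Spatial → Set
Sat s h emp = ∀ x → ¬ (x ∈Dom h)
Sat s h (t ↦ u) =
  (∀ x → (x ∈Dom h → x ≡ ⟦ t ⟧ₜ s) × (x ≡ ⟦ t ⟧ₜ s → x ∈Dom h))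
  × fun h (⟦ t ⟧ₜ s) ≡ just (⟦ u ⟧ₜ s)
Sat s h (arr t u) =
  ⟦ t ⟧ₜ s ≤ ⟦ u ⟧ₜ s ×
  (∀ x → (x ∈Dom h → ⟦ t ⟧ₜ s ≤ x × x ≤ ⟦ u ⟧ₜ s)
       × (⟦ t ⟧ₜ s ≤ x × x ≤ ⟦ u ⟧ₜ s → x ∈Dom h))
Sat s h (σ₁ ✶ σ₂) =
  Σ Heap λ h₁ → Σ Heap λ h₂ → DisjUnion h h₁ h₂ × Sat s h₁ σ₁ × Sat s h₂ σ₂

record SymHeap : Set where
  constructor _∧_
  field
    pure    : Pure
    spatial : Spatial

record ExSymHeap : Set where
  constructor ∃[_]_
  field
    bound : List Var
    body  : SymHeap
open ExSymHeap public

_,_⊨_ : Store → Heap → SymHeap → Set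
s , h ⊨ (π ∧ σ) = (s ⊨ₚ π) × Sat s h σ

SatEx : Store → Heap → List Var → SymHeap → Set
SatEx s h [] φ = s , h ⊨ φ
SatEx s h (y ∷ ys) φ = Σ ℕ λ n → SatEx (s [ y ≔ n ]) h ys φ

record Entailment : Set where
  field
    lhs : SymHeap
    rhs : List ExSymHeap
open Entailment public

AnySat : Store → Heap → List ExSymHeap → Set
AnySat s h [] = Data.Empty.⊥ where import Data.Empty
AnySat s h (e ∷ es) = SatEx s h (bound e) (body e) Data.Sum.⊎ AnySat s h es
  where import Data.Sum

Valid : Entailment → Set
Valid e = ∀ (s : Store) (h : Heap) → s , h ⊨ lhs e → AnySat s h (rhs e)

_occursIn_ : Var → Term → Set
x occursIn var y  = x ≡ y
x occursIn lit n  = Data.Empty.⊥ where import Data.Empty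
x occursIn (t ⊕ u) = (x occursIn t) Data.Sum.⊎ (x occursIn u) where import Data.Sum

ArrOK : List Var → Spatial → Set
ArrOK ys emp = ⊤
ArrOK ys (t ↦ u) = ⊤
ArrOK ys (arr t t′) = Σ Term λ u → (t′ ≡ t ⊕ u) × (∀ x → x occursIn u → x ∉ ys)
ArrOK ys (σ₁ ✶ σ₂) = ArrOK ys σ₁ × ArrOK ys σ₂

Restricted : Entailment → Set
Restricted e = All (λ d → ArrOK (bound d) (SymHeap.spatial (body d))) (rhs e)
  where open import Data.List.Relation.Unary.All using (All)

{-# OPTIONS --safe #-}

-- A spatial formula says that the domain of h is the union of the disjoint intervals given
-- by its atoms and fixes the contents of h at the finitely many addresses of ↦-atoms.  The
-- heap contents are the only higher-order part of validity.  On the right the sizes of all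
-- intervals depend on s alone, so the tilings of a given domain are determined by the
-- order of the tiles: an interval must start at the least address not yet tiled.  Hence
-- only a bounded number m of addresses can ever be those of a ↦-atom, and quantification
-- over heaps amounts to quantification over m address-value pairs, which leaves a
-- Presburger formula.
--
-- Presburger arithmetic is decided by a variant of Cooper's quantifier elimination: let D
-- be a common period of the divisibility atoms in q.  Along n, n + D, n + 2D, … the truth
-- value of q (n) only changes when some linear atom a n + r ≥ 0 does, in which case a n + r
-- is bounded, so that n is one of finitely many rationals u / a with u linear in the other
-- variables.

module Submission where

open import Defs
open import Data.Nat as ℕ using (ℕ; zero; suc; _≡ᵇ_; s≤s; z≤n)
import Data.Nat.Properties as ℕ
import Data.Nat.Divisibility as ℕ
open import Data.Nat.Induction using (<-wellFounded)
open import Data.Nat.ListAction using (sum)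
open import Induction.WellFounded using (Acc; acc)
open import Data.Integer as ℤ using (ℤ; +_; +0; +[1+_]; -[1+_]; -_; 0ℤ; 1ℤ; -1ℤ; ∣_∣)
import Data.Integer.Properties as ℤ
open import Data.Integer.Divisibility.Signed as ℤ using (_∣_; divides; _∣?_)
open import Data.Integer.Tactic.RingSolver using (solve-∀)
open import Data.Bool using (if_then_else_; true; false; T)
open import Data.Maybe using (Maybe; just; nothing; fromMaybe)
open import Data.Maybe.Properties using (just-injective)
open import Data.Product using (Σ; ∃; _×_; _,_; proj₁; proj₂)
open import Data.Product.Properties using (≡-dec)
open import Data.Product.Function.NonDependent.Propositional using (_×-⇔_)
open import Data.Sum as Sum using (_⊎_; inj₁; inj₂)
open import Data.Sum.Function.Propositional using (_⊎-⇔_)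
open import Data.Empty using (⊥; ⊥-elim)
open import Data.Unit using (⊤; tt)
open import Data.List using (List; []; _∷_; _++_; map; upTo; length; concatMap; filter)
open import Data.List.Properties using (length-++; length-map; map-++; filter-notAll)
open import Data.List.Membership.Propositional using (_∈_; _∉_; find; lose)
open import Data.List.Membership.Propositional.Properties
  using (∈-upTo⁺; ∈-concatMap⁺; ∈-filter⁺; ∈-filter⁻; ∈-map⁺)
open import Data.List.Relation.Unary.Any as Any using (Any; here; there)
import Data.List.Relation.Unary.Any.Properties as Any
open import Data.List.Relation.Unary.All as All using (All; []; _∷_)
open import Function using (_∘_; _⇔_; mk⇔; Equivalence)
open import Function.Related.TypeIsomorphisms using (¬-cong-⇔)
open import Function.Construct.Identity using (⇔-id)
open import Function.Construct.Composition using (_⇔-∘_)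
open import Function.Construct.Symmetry using (⇔-sym)
open import Relation.Unary using (Decidable)
open import Relation.Nullary using (¬_; Dec; yes; no; contradiction)
open import Relation.Nullary.Decidable as Dec using (_×-dec_; _⊎-dec_; ¬?; decidable-stable)
open import Relation.Binary.PropositionalEquality
  using (_≡_; _≢_; refl; sym; trans; cong; cong₂; subst; subst₂)
open Equivalence using (to; from)

-- Presburger arithmetic

-- Stores are kept in separate rows so that, for literals i and j, (e ⟨ i , x ≔ n ⟩) j reduces
-- to e j [ x ≔ n ] or to e j, without freshness conditions on the variables.
Slot : Set
Slot = ℕ × Var

Env : Set
Env = ℕ → Store

_⟨_≔_⟩ : Env → Slot → ℕ → Env
(e ⟨ i , x ≔ n ⟩) j = if j ≡ᵇ i then e j [ x ≔ n ] else e j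

_!_ : Env → Slot → ℕ
e ! (i , x) = e i x

_≟_ : (v w : Slot) → Dec (v ≡ w)
_≟_ = ≡-dec ℕ._≟_ ℕ._≟_

≡ᵇ-refl : ∀ n → (n ≡ᵇ n) ≡ true
≡ᵇ-refl zero = refl
≡ᵇ-refl (suc n) = ≡ᵇ-refl n

≢⇒≡ᵇ : ∀ {m n} → m ≢ n → (m ≡ᵇ n) ≡ false
≢⇒≡ᵇ {m} {n} m≢n with m ≡ᵇ n in eq
... | true = contradiction (ℕ.≡ᵇ⇒≡ m n (subst T (sym eq) tt)) m≢n
... | false = refl

store-other : ∀ s {x y n} → y ≢ x → (s [ x ≔ n ]) y ≡ s y
store-other s y≢x rewrite ≢⇒≡ᵇ y≢x = refl

update-same : ∀ e v n → (e ⟨ v ≔ n ⟩) ! v ≡ n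
update-same e (i , x) n rewrite ≡ᵇ-refl i | ≡ᵇ-refl x = refl

update-other : ∀ e {v w} n → w ≢ v → (e ⟨ v ≔ n ⟩) ! w ≡ e ! w
update-other e {i , x} {j , y} n w≢v with j ≡ᵇ i in eq
... | false = refl
... | true = store-other (e j) λ y≡x →
  w≢v (cong₂ _,_ (ℕ.≡ᵇ⇒≡ j i (subst T (sym eq) tt)) y≡x)

-- Linear terms and quantifier-free formulas.

infixl 6 _⊞_
infixl 7 _⊡_

data Lin : Set where
  con : ℤ → Lin
  slot : Slot → Lin
  _⊞_ : Lin → Lin → Lin
  _⊡_ : ℤ → Lin → Lin

eval : Lin → Env → ℤ
eval (con k) e = k
eval (slot v) e = + (e ! v)
eval (t ⊞ u) e = eval t e ℤ.+ eval u e
eval (k ⊡ t) e = k ℤ.* eval t e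

coef : Slot → Lin → ℤ
coef v (con k) = 0ℤ
coef v (slot w) with w ≟ v
... | yes _ = 1ℤ
... | no _ = 0ℤ
coef v (t ⊞ u) = coef v t ℤ.+ coef v u
coef v (k ⊡ t) = k ℤ.* coef v t

rest : Slot → Lin → Lin
rest v (con k) = con k
rest v (slot w) with w ≟ v
... | yes _ = con 0ℤ
... | no _ = slot w
rest v (t ⊞ u) = rest v t ⊞ rest v u
rest v (k ⊡ t) = k ⊡ rest v t

-- `rest v t` no longer mentions `v`, so it is evaluated before the update, and the value becomes
-- affine in `n`.
eval-update : ∀ t e v n →
  eval t (e ⟨ v ≔ n ⟩) ≡ coef v t ℤ.* + n ℤ.+ eval (rest v t) e
eval-update (con k) e v n = sym (ℤ.+-identityˡ k)
eval-update (slot w) e v n with w ≟ v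
... | yes refl = trans (cong +_ (update-same e v n)) (lemma (+ n))
  where
  lemma : ∀ m → m ≡ 1ℤ ℤ.* m ℤ.+ 0ℤ
  lemma = solve-∀
... | no w≢v = trans (cong +_ (update-other e n w≢v)) (sym (ℤ.+-identityˡ _))
eval-update (t ⊞ u) e v n rewrite eval-update t e v n | eval-update u e v n =
  lemma (coef v t) (coef v u) (+ n) (eval (rest v t) e) (eval (rest v u) e)
  where
  lemma : ∀ a b m r q →
    a ℤ.* m ℤ.+ r ℤ.+ (b ℤ.* m ℤ.+ q) ≡ (a ℤ.+ b) ℤ.* m ℤ.+ (r ℤ.+ q)
  lemma = solve-∀
eval-update (k ⊡ t) e v n rewrite eval-update t e v n =
  lemma k (coef v t) (+ n) (eval (rest v t) e)
  where
  lemma : ∀ k a m r → k ℤ.* (a ℤ.* m ℤ.+ r) ≡ k ℤ.* a ℤ.* m ℤ.+ k ℤ.* r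
  lemma = solve-∀

-- The modulus of dvd d is suc d, so that it is never 0.
data QF : Set where
  nonneg : Lin → QF
  dvd : ℕ → Lin → QF
  and : QF → QF → QF
  not : QF → QF

Holds : QF → Env → Set
Holds (nonneg t) e = 0ℤ ℤ.≤ eval t e
Holds (dvd d t) e = +[1+ d ] ∣ eval t e
Holds (and p q) e = Holds p e × Holds q e
Holds (not p) e = ¬ Holds p e

holds? : ∀ q e → Dec (Holds q e)
holds? (nonneg t) e = 0ℤ ℤ.≤? eval t e
holds? (dvd d t) e = +[1+ d ] ∣? eval t e
holds? (and p q) e = holds? p e ×-dec holds? q e
holds? (not p) e = ¬? (holds? p e)

-- (k , u) stands for the rational u / (suc k).
Quotient : Set
Quotient = ℕ × Lin

-- Atoms are multiplied through by the denominator. Being positive, it preserves signs; in a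
-- divisibility the modulus is multiplied as well, and `suc (d + k * suc d)` is `suc k * suc d`.
substitute : Slot → Quotient → QF → QF
substitute v (k , u) (nonneg t) = nonneg (coef v t ⊡ u ⊞ +[1+ k ] ⊡ rest v t)
substitute v (k , u) (dvd d t) = dvd (d ℕ.+ k ℕ.* suc d) (coef v t ⊡ u ⊞ +[1+ k ] ⊡ rest v t)
substitute v c (and p q) = and (substitute v c p) (substitute v c q)
substitute v c (not p) = not (substitute v c p)

Hits : ℕ → Env → Quotient → Set
Hits n e (k , u) = +[1+ k ] ℤ.* + n ≡ eval u e

clear-denominator : ∀ v k u t e n → Hits n e (k , u) →
  +[1+ k ] ℤ.* eval t (e ⟨ v ≔ n ⟩) ≡ eval (coef v t ⊡ u ⊞ +[1+ k ] ⊡ rest v t) e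
clear-denominator v k u t e n hit rewrite eval-update t e v n | sym hit =
  lemma +[1+ k ] (coef v t) (+ n) (eval (rest v t) e)
  where
  lemma : ∀ k c m r → k ℤ.* (c ℤ.* m ℤ.+ r) ≡ c ℤ.* (k ℤ.* m) ℤ.+ k ℤ.* r
  lemma = solve-∀

scale-nonneg : ∀ k {i j} → +[1+ k ] ℤ.* i ≡ j → (0ℤ ℤ.≤ i) ⇔ (0ℤ ℤ.≤ j)
scale-nonneg k {i} refl = mk⇔
  (λ 0≤i → subst (ℤ._≤ +[1+ k ] ℤ.* i) (ℤ.*-zeroʳ +[1+ k ]) (ℤ.*-monoˡ-≤-nonNeg +[1+ k ] 0≤i))
  (λ 0≤ki → ℤ.*-cancelˡ-≤-pos 0ℤ i +[1+ k ]
    (subst (ℤ._≤ +[1+ k ] ℤ.* i) (sym (ℤ.*-zeroʳ +[1+ k ])) 0≤ki))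

scale-dvd : ∀ k d {i j} → +[1+ k ] ℤ.* i ≡ j →
  (+[1+ d ] ∣ i) ⇔ (+[1+ d ℕ.+ k ℕ.* suc d ] ∣ j)
scale-dvd k d {i} refl = mk⇔
  (λ d∣i → ℤ.*-monoʳ-∣ +[1+ k ] {+[1+ d ]} {i} d∣i)
  (λ kd∣ki → ℤ.*-cancelˡ-∣ +[1+ k ] {+[1+ d ]} {i} kd∣ki)

substitute-correct : ∀ v c q e n → Hits n e c →
  Holds q (e ⟨ v ≔ n ⟩) ⇔ Holds (substitute v c q) e
substitute-correct v (k , u) (nonneg t) e n hit =
  scale-nonneg k (clear-denominator v k u t e n hit)
substitute-correct v (k , u) (dvd d t) e n hit =
  scale-dvd k d (clear-denominator v k u t e n hit)
substitute-correct v c (and p q) e n hit =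
  substitute-correct v c p e n hit ×-⇔ substitute-correct v c q e n hit
substitute-correct v c (not p) e n hit = ¬-cong-⇔ (substitute-correct v c p e n hit)

-- The product stands in for the least common multiple: any positive common multiple of the moduli
-- can serve as the step.
period : QF → ℕ
period (nonneg t) = 1
period (dvd d t) = suc d
period (and p q) = period p ℕ.* period q
period (not p) = period p

-- If nonneg t has different truth values at v = n and v = n + D, then n + D is one of these.
crossings : Slot → ℕ → Lin → List Quotient
crossings v D t with coef v t
... | +0 = []
... | +[1+ k ] = map (λ j → k , con (+ j) ⊞ -1ℤ ⊡ rest v t) (upTo (suc (suc k ℕ.* D)))
... | -[1+ k ] = map (λ j → k , con (+ j) ⊞ rest v t) (upTo (suc (suc k ℕ.* D)))

candidates : Slot → ℕ → QF → List Quotient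
candidates v D (nonneg t) = crossings v D t
candidates v D (dvd d t) = []
candidates v D (and p q) = candidates v D p ++ candidates v D q
candidates v D (not p) = candidates v D p

0≤-+ : ∀ {i} k → 0ℤ ℤ.≤ i → 0ℤ ℤ.≤ i ℤ.+ + k
0≤-+ k 0≤i = ℤ.+-mono-≤ 0≤i (ℤ.+≤+ (z≤n {k}))

≰0⇒neg : ∀ {i} → ¬ (0ℤ ℤ.≤ i) → ∃ λ m → i ≡ -[1+ m ]
≰0⇒neg {+ n} 0≰i = contradiction (ℤ.+≤+ z≤n) 0≰i
≰0⇒neg { -[1+ m ]} _ = m , refl

sign-change-above : ∀ i k → ¬ (0ℤ ℤ.≤ i) → 0ℤ ℤ.≤ i ℤ.+ + k →
  ∃ λ j → i ℤ.+ + k ≡ + j × j ℕ.≤ k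
sign-change-above i k 0≰i 0≤i+k =
  ∣ i ℤ.+ + k ∣ , sym |i+k| , ℤ.drop‿+≤+ (subst (ℤ._≤ + k) (sym |i+k|)
    (subst (i ℤ.+ + k ℤ.≤_) (ℤ.+-identityˡ (+ k)) (ℤ.+-monoˡ-≤ (+ k) (ℤ.<⇒≤ (ℤ.≰⇒> 0≰i)))))
  where
  |i+k| : + ∣ i ℤ.+ + k ∣ ≡ i ℤ.+ + k
  |i+k| = ℤ.0≤i⇒+∣i∣≡i 0≤i+k

sign-change-below : ∀ i k → ¬ (0ℤ ℤ.≤ i) → 0ℤ ℤ.≤ i ℤ.+ + k →
  ∃ λ j → i ≡ - (+ j) × j ℕ.≤ k
sign-change-below i k 0≰i 0≤i+k with ≰0⇒neg 0≰i
... | m , refl = suc m , refl , ℤ.drop‿+≤+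
  (subst₂ ℤ._≤_ (ℤ.+-identityʳ +[1+ m ]) (lemma +[1+ m ] (+ k)) (ℤ.+-monoʳ-≤ +[1+ m ] 0≤i+k))
  where
  lemma : ∀ x y → x ℤ.+ (- x ℤ.+ y) ≡ y
  lemma = solve-∀

-- A step of `D` changes the value of `t` by exactly `gap` up or down. If the sign changes, the
-- value at `n + D` is therefore `j` for a positive coefficient and `- j` for a negative one, with
-- `j` at most `gap`; solving for `n + D` gives a member of `crossings`.
crossing : ∀ v t D e n →
  Any (Hits (n ℕ.+ D) e) (crossings v D t) ⊎
  (Holds (nonneg t) (e ⟨ v ≔ n ⟩) ⇔ Holds (nonneg t) (e ⟨ v ≔ n ℕ.+ D ⟩))
crossing v t D e n
  rewrite eval-update t e v n | eval-update t e v (n ℕ.+ D)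
  with coef v t
... | +0 = inj₂ (⇔-id _)
... | +[1+ k ] = go
  where
  r = eval (rest v t) e
  lo = +[1+ k ] ℤ.* + n ℤ.+ r
  hi = +[1+ k ] ℤ.* + (n ℕ.+ D) ℤ.+ r
  gap = suc k ℕ.* D

  ring : ∀ a n d r → a ℤ.* (n ℤ.+ d) ℤ.+ r ≡ a ℤ.* n ℤ.+ r ℤ.+ a ℤ.* d
  ring = solve-∀

  hi≡ : hi ≡ lo ℤ.+ + gap
  hi≡ = trans (ring +[1+ k ] (+ n) (+ D) r) (cong (λ x → lo ℤ.+ x) (sym (ℤ.pos-* (suc k) D)))

  solution : ∀ {a n r j} → a ℤ.* n ℤ.+ r ≡ j → a ℤ.* n ≡ j ℤ.+ -1ℤ ℤ.* r
  solution {a} {n} {r} refl = lemma a n r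
    where
    lemma : ∀ a n r → a ℤ.* n ≡ a ℤ.* n ℤ.+ r ℤ.+ -1ℤ ℤ.* r
    lemma = solve-∀

  go : Any (Hits (n ℕ.+ D) e) (map (λ j → k , con (+ j) ⊞ -1ℤ ⊡ rest v t) (upTo (suc gap))) ⊎
       ((0ℤ ℤ.≤ lo) ⇔ (0ℤ ℤ.≤ hi))
  go with 0ℤ ℤ.≤? lo | 0ℤ ℤ.≤? hi
  ... | yes p | yes q = inj₂ (mk⇔ (λ _ → q) (λ _ → p))
  ... | no ¬p | no ¬q = inj₂ (mk⇔ (⊥-elim ∘ ¬p) (⊥-elim ∘ ¬q))
  ... | yes p | no ¬q = contradiction (subst (0ℤ ℤ.≤_) (sym hi≡) (0≤-+ gap p)) ¬q
  ... | no ¬p | yes q with sign-change-above lo gap ¬p (subst (0ℤ ℤ.≤_) hi≡ q)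
  ...   | j , eq , j≤ = inj₁ (Any.map⁺
    (Any.map (λ { refl → solution {+[1+ k ]} (trans hi≡ eq) }) (∈-upTo⁺ (s≤s j≤))))
... | -[1+ k ] = go
  where
  r = eval (rest v t) e
  -- With a negative coefficient the value at `n` is the larger one.
  hi = -[1+ k ] ℤ.* + n ℤ.+ r
  lo = -[1+ k ] ℤ.* + (n ℕ.+ D) ℤ.+ r
  gap = suc k ℕ.* D

  ring : ∀ a n d r → - a ℤ.* n ℤ.+ r ≡ - a ℤ.* (n ℤ.+ d) ℤ.+ r ℤ.+ a ℤ.* d
  ring = solve-∀

  hi≡ : hi ≡ lo ℤ.+ + gap
  hi≡ = trans (ring +[1+ k ] (+ n) (+ D) r) (cong (λ x → lo ℤ.+ x) (sym (ℤ.pos-* (suc k) D)))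

  solution : ∀ {a n r j} → - a ℤ.* n ℤ.+ r ≡ - j → a ℤ.* n ≡ j ℤ.+ r
  solution {a} {n} {r} {j} eq =
    trans (lemma a n r) (trans (cong (λ x → - x ℤ.+ r) eq) (cong (ℤ._+ r) (ℤ.neg-involutive j)))
    where
    lemma : ∀ a n r → a ℤ.* n ≡ - (- a ℤ.* n ℤ.+ r) ℤ.+ r
    lemma = solve-∀

  go : Any (Hits (n ℕ.+ D) e) (map (λ j → k , con (+ j) ⊞ rest v t) (upTo (suc gap))) ⊎
       ((0ℤ ℤ.≤ hi) ⇔ (0ℤ ℤ.≤ lo))
  go with 0ℤ ℤ.≤? lo | 0ℤ ℤ.≤? hi
  ... | yes p | yes q = inj₂ (mk⇔ (λ _ → p) (λ _ → q))
  ... | no ¬p | no ¬q = inj₂ (mk⇔ (⊥-elim ∘ ¬q) (⊥-elim ∘ ¬p))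
  ... | yes p | no ¬q = contradiction (subst (0ℤ ℤ.≤_) (sym hi≡) (0≤-+ gap p)) ¬q
  ... | no ¬p | yes q with sign-change-below lo gap ¬p (subst (0ℤ ℤ.≤_) hi≡ q)
  ...   | j , eq , j≤ = inj₁ (Any.map⁺
    (Any.map (λ { refl → solution {+[1+ k ]} eq }) (∈-upTo⁺ (s≤s j≤))))

-- Divisibility atoms are periodic and survive the step; an inequality that changes makes `n + D` a
-- candidate. If no atom reports a hit, the equivalences combine along the connectives.
shift : ∀ v q D e n → period q ℕ.∣ D →
  Any (Hits (n ℕ.+ D) e) (candidates v D q) ⊎
  (Holds q (e ⟨ v ≔ n ⟩) ⇔ Holds q (e ⟨ v ≔ n ℕ.+ D ⟩))
shift v (nonneg t) D e n _ = crossing v t D e n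
shift v (dvd d t) D e n (ℕ.divides m refl)
  rewrite eval-update t e v n | eval-update t e v (n ℕ.+ m ℕ.* suc d) =
  inj₂ (mk⇔ forth back)
  where
  c = coef v t
  r = eval (rest v t) e

  forth : +[1+ d ] ∣ (c ℤ.* + n ℤ.+ r) → +[1+ d ] ∣ (c ℤ.* + (n ℕ.+ m ℕ.* suc d) ℤ.+ r)
  forth (divides z eq) = divides (z ℤ.+ c ℤ.* + m)
    (trans (cong (λ x → c ℤ.* (+ n ℤ.+ x) ℤ.+ r) (ℤ.pos-* m (suc d)))
      (trans (lemma₁ c (+ n) (+ m) +[1+ d ] r) (trans (cong (ℤ._+ c ℤ.* + m ℤ.* +[1+ d ]) eq)
        (sym (ℤ.*-distribʳ-+ +[1+ d ] z (c ℤ.* + m))))))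
    where
    lemma₁ : ∀ c n m d r → c ℤ.* (n ℤ.+ m ℤ.* d) ℤ.+ r ≡ c ℤ.* n ℤ.+ r ℤ.+ c ℤ.* m ℤ.* d
    lemma₁ = solve-∀

  back : +[1+ d ] ∣ (c ℤ.* + (n ℕ.+ m ℕ.* suc d) ℤ.+ r) → +[1+ d ] ∣ (c ℤ.* + n ℤ.+ r)
  back (divides z eq) = divides (z ℤ.- c ℤ.* + m)
    (trans (lemma₂ c (+ n) (+ m) +[1+ d ] r)
      (trans (cong (ℤ._- c ℤ.* + m ℤ.* +[1+ d ])
               (trans (cong (λ x → c ℤ.* (+ n ℤ.+ x) ℤ.+ r) (sym (ℤ.pos-* m (suc d)))) eq))
        (lemma₃ z (c ℤ.* + m) +[1+ d ])))
    where
    lemma₂ : ∀ c n m d r → c ℤ.* n ℤ.+ r ≡ c ℤ.* (n ℤ.+ m ℤ.* d) ℤ.+ r ℤ.- c ℤ.* m ℤ.* d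
    lemma₂ = solve-∀
    lemma₃ : ∀ z x d → z ℤ.* d ℤ.- x ℤ.* d ≡ (z ℤ.- x) ℤ.* d
    lemma₃ = solve-∀
shift v (and p q) D e n pq∣D
  with shift v p D e n (ℕ.∣-trans (ℕ.m∣m*n (period q)) pq∣D)
     | shift v q D e n (ℕ.∣-trans (ℕ.n∣m*n (period p)) pq∣D)
... | inj₁ hit | _ = inj₁ (Any.++⁺ˡ hit)
... | inj₂ _ | inj₁ hit = inj₁ (Any.++⁺ʳ (candidates v D p) hit)
... | inj₂ f | inj₂ g = inj₂ (f ×-⇔ g)
shift v (not p) D e n p∣D with shift v p D e n p∣D
... | inj₁ hit = inj₁ hit
... | inj₂ f = inj₂ (¬-cong-⇔ f)

-- Relations definable in Presburger arithmetic.

Definable : (Env → Set) → Set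
Definable R = Σ QF λ q → ∀ e → R e ⇔ Holds q e

private variable R S : Env → Set

-- This is why `Definable` asks for a quantifier-free formula: closure under `∃` then amounts to
-- quantifier elimination, and classical reasoning about definable relations is constructively
-- sound.
definable⇒dec : Definable R → ∀ e → Dec (R e)
definable⇒dec (q , correct) e = Dec.map (⇔-sym (correct e)) (holds? q e)

definable-map : (∀ e → R e ⇔ S e) → Definable R → Definable S
definable-map R⇔S (q , correct) = q , λ e → correct e ⇔-∘ ⇔-sym (R⇔S e)

¬-definable : Definable R → Definable (λ e → ¬ R e)
¬-definable (q , correct) = not q , λ e → ¬-cong-⇔ (correct e)

×-definable : Definable R → Definable S → Definable (λ e → R e × S e)
×-definable (p , f) (q , g) = and p q , λ e → f e ×-⇔ g e

-- De Morgan's law expresses the disjunction that `QF` lacks; decidability removes the double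
-- negation.
⊎-definable : Definable R → Definable S → Definable (λ e → R e ⊎ S e)
⊎-definable {R} {S} r s =
  definable-map equiv (¬-definable (×-definable (¬-definable r) (¬-definable s)))
  where
  equiv : ∀ e → (¬ (¬ R e × ¬ S e)) ⇔ (R e ⊎ S e)
  equiv e = mk⇔
    (λ ¬¬ → decidable-stable (definable⇒dec r e ⊎-dec definable⇒dec s e)
      λ ¬R⊎S → ¬¬ (¬R⊎S ∘ inj₁ , ¬R⊎S ∘ inj₂))
    (λ { (inj₁ x) (¬x , _) → ¬x x ; (inj₂ y) (_ , ¬y) → ¬y y })

→-definable : Definable R → Definable S → Definable (λ e → R e → S e)
→-definable {R} {S} r s = definable-map equiv (⊎-definable (¬-definable r) s)
  where
  equiv : ∀ e → (¬ R e ⊎ S e) ⇔ (R e → S e)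
  equiv e = mk⇔ (λ { (inj₁ ¬x) x → contradiction x ¬x ; (inj₂ y) _ → y }) back
    where
    back : (R e → S e) → ¬ R e ⊎ S e
    back f with definable⇒dec r e
    ... | yes x = inj₂ (f x)
    ... | no ¬x = inj₁ ¬x

⊤-definable : Definable (λ _ → ⊤)
⊤-definable = nonneg (con 0ℤ) , λ _ → mk⇔ (λ _ → ℤ.≤-refl) (λ _ → tt)

⊥-definable : Definable (λ _ → ⊥)
⊥-definable = definable-map (λ _ → mk⇔ (λ ¬⊤ → ¬⊤ tt) λ ()) (¬-definable ⊤-definable)

any-definable : {A : Set} {R : A → Env → Set} → (∀ a → Definable (R a)) →
  ∀ as → Definable (λ e → Any (λ a → R a e) as)
any-definable r [] = definable-map (λ _ → mk⇔ (λ ()) (λ ())) ⊥-definable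
any-definable r (a ∷ as) =
  definable-map (λ _ → mk⇔ Any.fromSum Any.toSum) (⊎-definable (r a) (any-definable r as))

⇔-definable : Definable R → Definable S → Definable (λ e → R e ⇔ S e)
⇔-definable r s = definable-map (λ e → mk⇔ (λ (f , g) → mk⇔ f g) (λ h → to h , from h))
  (×-definable (→-definable r s) (→-definable s r))

all-definable : {A : Set} {R : A → Env → Set} → (∀ a → Definable (R a)) →
  ∀ as → Definable (λ e → All (λ a → R a e) as)
all-definable r [] = definable-map (λ _ → mk⇔ (λ _ → []) (λ _ → tt)) ⊤-definable
all-definable r (a ∷ as) = definable-map (λ _ → mk⇔ (λ (p , ps) → p ∷ ps) (λ { (p ∷ ps) → p , ps }))
  (×-definable (r a) (all-definable r as))

-- A witness n > D either hits a candidate or can be replaced by n ∸ D.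
module Elimination (v : Slot) (q : QF) where

  D : ℕ
  D = period q

  -- The numbers `0` to `D`, written with denominator 1, catch the descent in steps of `D` when it
  -- has met no crossing.
  pool : List Quotient
  pool = map (λ j → 0 , con (+ j)) (upTo (suc D)) ++ candidates v D q

  -- The first two conjuncts make the fraction a natural number: `dvd k` has the denominator `suc k`
  -- as its modulus.
  Works : Quotient → Env → Set
  Works c@(k , u) e =
    (Holds (nonneg u) e × Holds (dvd k u) e) × Holds (substitute v c q) e

  period>0 : ∀ q → 0 ℕ.< period q
  period>0 (nonneg t) = s≤s z≤n
  period>0 (dvd d t) = s≤s z≤n
  period>0 (and p q) = ℕ.*-mono-≤ (period>0 p) (period>0 q)
  period>0 (not p) = period>0 p

  works⇒witness : ∀ c e → Works c e → ∃ λ n → Holds q (e ⟨ v ≔ n ⟩)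
  works⇒witness (k , u) e ((0≤u , divides z eq) , h) =
    ∣ z ∣ , from (substitute-correct v (k , u) q e ∣ z ∣ hit) h
    where
    0≤z : 0ℤ ℤ.≤ z
    0≤z = ℤ.*-cancelʳ-≤-pos 0ℤ z +[1+ k ] (subst (0ℤ ℤ.≤_) eq 0≤u)
    hit : Hits ∣ z ∣ e (k , u)
    hit = trans (cong (+[1+ k ] ℤ.*_) (ℤ.0≤i⇒+∣i∣≡i 0≤z)) (trans (ℤ.*-comm +[1+ k ] z) (sym eq))

  hit⇒works : ∀ e n → Holds q (e ⟨ v ≔ n ⟩) → ∀ {c} → Hits n e c → Works c e
  hit⇒works e n h {k , u} hit =
    (subst (0ℤ ℤ.≤_) eq (ℤ.+≤+ z≤n) , divides (+ n) (trans (sym hit) (ℤ.*-comm +[1+ k ] (+ n)))) ,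
    to (substitute-correct v (k , u) q e n hit) h
    where
    eq : + (suc k ℕ.* n) ≡ eval u e
    eq = trans (ℤ.pos-* (suc k) n) hit

  witness⇒works : ∀ e n → Acc ℕ._<_ n → Holds q (e ⟨ v ≔ n ⟩) → Any (λ c → Works c e) pool
  witness⇒works e n (acc rec) h with n ℕ.≤? D
  ... | yes n≤D = Any.++⁺ˡ (Any.map⁺
    (Any.map (λ { refl → hit⇒works e n h (ℤ.*-identityˡ (+ n)) }) (∈-upTo⁺ (s≤s n≤D))))
  ... | no n≰D with ℕ.m≤n⇒∃[o]m+o≡n (ℕ.≰⇒≥ n≰D)
  ...   | m , refl rewrite ℕ.+-comm D m with shift v q D e m ℕ.∣-refl
  ...     | inj₁ hit = Any.++⁺ʳ (map (λ j → 0 , con (+ j)) (upTo (suc D)))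
      (Any.map (hit⇒works e (m ℕ.+ D) h) hit)
  ...     | inj₂ f = witness⇒works e m (rec (ℕ.m<m+n m (period>0 q))) (from f h)

∃-definable : ∀ v {R} → Definable R → Definable (λ e → ∃ λ n → R (e ⟨ v ≔ n ⟩))
∃-definable v {R} (q , correct) = definable-map equiv (any-definable works-definable pool)
  where
  open Elimination v q
  works-definable : ∀ c → Definable (Works c)
  works-definable c@(k , u) = and (and (nonneg u) (dvd k u)) (substitute v c q) , λ _ → ⇔-id _
  equiv : ∀ e → Any (λ c → Works c e) pool ⇔ ∃ λ n → R (e ⟨ v ≔ n ⟩)
  equiv e = mk⇔
    (λ works → let c , w = Any.satisfied works ; n , h = works⇒witness c e w in n , from (correct _) h)
    (λ (n , r) → witness⇒works e n (<-wellFounded n) (to (correct _) r))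

∀-definable : ∀ v {R} → Definable R → Definable (λ e → ∀ n → R (e ⟨ v ≔ n ⟩))
∀-definable v r = definable-map
  (λ e → mk⇔ (λ ¬∃ n → decidable-stable (definable⇒dec r _) λ ¬r → ¬∃ (n , ¬r)) (λ f (n , ¬r) → ¬r (f n)))
  (¬-definable (∃-definable v (¬-definable r)))

-- Renaming of rows, and quantification over all environments.

rename-lin : (ℕ → ℕ) → Lin → Lin
rename-lin ρ (con k) = con k
rename-lin ρ (slot (i , x)) = slot (ρ i , x)
rename-lin ρ (t ⊞ u) = rename-lin ρ t ⊞ rename-lin ρ u
rename-lin ρ (k ⊡ t) = k ⊡ rename-lin ρ t

rename : (ℕ → ℕ) → QF → QF
rename ρ (nonneg t) = nonneg (rename-lin ρ t)
rename ρ (dvd d t) = dvd d (rename-lin ρ t)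
rename ρ (and p q) = and (rename ρ p) (rename ρ q)
rename ρ (not p) = not (rename ρ p)

eval-rename : ∀ ρ t e → eval (rename-lin ρ t) e ≡ eval t (e ∘ ρ)
eval-rename ρ (con k) e = refl
eval-rename ρ (slot v) e = refl
eval-rename ρ (t ⊞ u) e = cong₂ ℤ._+_ (eval-rename ρ t e) (eval-rename ρ u e)
eval-rename ρ (k ⊡ t) e = cong (k ℤ.*_) (eval-rename ρ t e)

holds-rename : ∀ ρ q e → Holds q (e ∘ ρ) ⇔ Holds (rename ρ q) e
holds-rename ρ (nonneg t) e rewrite eval-rename ρ t e = ⇔-id _
holds-rename ρ (dvd d t) e rewrite eval-rename ρ t e = ⇔-id _
holds-rename ρ (and p q) e = holds-rename ρ p e ×-⇔ holds-rename ρ q e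
holds-rename ρ (not p) e = ¬-cong-⇔ (holds-rename ρ p e)

-- Relations translated for one row are reused for another in this way. As quantifiers have already
-- been eliminated, no variable can be captured, even when `ρ` identifies rows.
rename-definable : ∀ ρ {R} → Definable R → Definable (λ e → R (e ∘ ρ))
rename-definable ρ (q , correct) = rename ρ q , λ e → holds-rename ρ q e ⇔-∘ correct (e ∘ ρ)

slots-lin : Lin → List Slot
slots-lin (con k) = []
slots-lin (slot v) = v ∷ []
slots-lin (t ⊞ u) = slots-lin t ++ slots-lin u
slots-lin (k ⊡ t) = slots-lin t

slots : QF → List Slot
slots (nonneg t) = slots-lin t
slots (dvd d t) = slots-lin t
slots (and p q) = slots p ++ slots q
slots (not p) = slots p

AgreeOn : List Slot → Env → Env → Set
AgreeOn vs e e′ = ∀ {v} → v ∈ vs → e ! v ≡ e′ ! v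

eval-cong : ∀ t {e e′} → AgreeOn (slots-lin t) e e′ → eval t e ≡ eval t e′
eval-cong (con k) agree = refl
eval-cong (slot v) agree = cong +_ (agree (here refl))
eval-cong (t ⊞ u) agree =
  cong₂ ℤ._+_ (eval-cong t (agree ∘ Any.++⁺ˡ)) (eval-cong u (agree ∘ Any.++⁺ʳ (slots-lin t)))
eval-cong (k ⊡ t) agree = cong (k ℤ.*_) (eval-cong t agree)

holds-cong : ∀ q {e e′} → AgreeOn (slots q) e e′ → Holds q e ⇔ Holds q e′
holds-cong (nonneg t) agree rewrite eval-cong t agree = ⇔-id _
holds-cong (dvd d t) agree rewrite eval-cong t agree = ⇔-id _
holds-cong (and p q) agree =
  holds-cong p (agree ∘ Any.++⁺ˡ) ×-⇔ holds-cong q (agree ∘ Any.++⁺ʳ (slots p))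
holds-cong (not p) agree = ¬-cong-⇔ (holds-cong p agree)

∀-slots : List Slot → (Env → Set) → Env → Set
∀-slots [] R e = R e
∀-slots (v ∷ vs) R e = ∀ n → ∀-slots vs R (e ⟨ v ≔ n ⟩)

∀-slots-definable : ∀ vs {R} → Definable R → Definable (∀-slots vs R)
∀-slots-definable [] r = r
∀-slots-definable (v ∷ vs) r = ∀-definable v (∀-slots-definable vs r)

∀-slots-intro : ∀ vs {R : Env → Set} → (∀ e → R e) → ∀ e → ∀-slots vs R e
∀-slots-intro [] f e = f e
∀-slots-intro (v ∷ vs) f e n = ∀-slots-intro vs f (e ⟨ v ≔ n ⟩)

-- Each quantifier is instantiated with the value of `e` at its slot. The second alternative records
-- the slots where agreement with `e` has been reached already, which later updates preserve.
∀-slots-elim : ∀ vs {R : Env → Set} e e₀ → ∀-slots vs R e₀ →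
  ∃ λ e′ → R e′ × ∀ w → w ∈ vs ⊎ e₀ ! w ≡ e ! w → e′ ! w ≡ e ! w
∀-slots-elim [] e e₀ r = e₀ , r , λ { w (inj₂ eq) → eq }
∀-slots-elim (v ∷ vs) e e₀ f with ∀-slots-elim vs e (e₀ ⟨ v ≔ e ! v ⟩) (f (e ! v))
... | e′ , r , agree = e′ , r , λ w w∈⊎eq → agree w (step w w∈⊎eq)
  where
  step : ∀ w → w ∈ v ∷ vs ⊎ e₀ ! w ≡ e ! w → w ∈ vs ⊎ (e₀ ⟨ v ≔ e ! v ⟩) ! w ≡ e ! w
  step w w∈⊎eq with w ≟ v
  ... | yes refl = inj₂ (update-same e₀ v (e ! v))
  step w (inj₁ (here w≡v)) | no w≢v = contradiction w≡v w≢v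
  step w (inj₁ (there w∈vs)) | no w≢v = inj₁ w∈vs
  step w (inj₂ eq) | no w≢v = inj₂ (trans (update-other e₀ _ w≢v) eq)

-- An environment is an infinite object, but `q` depends on finitely many slots only. Closing
-- universally over these leaves a definable relation, which is decided at an arbitrary environment.
presburger-decidable : ∀ {R} → Definable R → Dec (∀ e → R e)
presburger-decidable {R} r@(q , correct) =
  Dec.map′ elim (λ f → ∀-slots-intro (slots q) f e₀)
    (definable⇒dec (∀-slots-definable (slots q) r) e₀)
  where
  e₀ : Env
  e₀ _ _ = 0
  elim : ∀-slots (slots q) R e₀ → ∀ e → R e
  elim f e with ∀-slots-elim (slots q) e e₀ f
  ... | e′ , r , agree = from (correct e)
    (to (holds-cong q (λ v∈ → agree _ (inj₁ v∈))) (to (correct e′) r))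

-- Translation of terms and pure formulas.

Linear : (Env → ℕ) → Set
Linear f = Σ Lin λ t → ∀ e → eval t e ≡ + f e

const-linear : ∀ n → Linear (λ _ → n)
const-linear n = con (+ n) , λ _ → refl

slot-linear : ∀ v → Linear (_! v)
slot-linear v = slot v , λ _ → refl

term-linear : ∀ i t → Linear (λ e → ⟦ t ⟧ₜ (e i))
term-linear i (var x) = slot-linear (i , x)
term-linear i (lit n) = const-linear n
term-linear i (t ⊕ u) with term-linear i t | term-linear i u
... | a , p | b , q = a ⊞ b , λ e → cong₂ ℤ._+_ (p e) (q e)

≤-definable : ∀ {f g : Env → ℕ} → Linear f → Linear g → Definable (λ e → f e ℕ.≤ g e)
≤-definable {f} {g} (a , p) (b , q) = nonneg (b ⊞ -1ℤ ⊡ a) , λ e → mk⇔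
  (λ f≤g → subst (0ℤ ℤ.≤_) (sym (value e)) (ℤ.i≤j⇒0≤j-i (ℤ.+≤+ f≤g)))
  (λ 0≤ → ℤ.drop‿+≤+ (ℤ.0≤i-j⇒j≤i (subst (0ℤ ℤ.≤_) (value e) 0≤)))
  where
  value : ∀ e → eval (b ⊞ -1ℤ ⊡ a) e ≡ + g e ℤ.- + f e
  value e = cong₂ ℤ._+_ (q e) (trans (ℤ.-1*i≡-i _) (cong -_ (p e)))

≡-definable : ∀ {f g : Env → ℕ} → Linear f → Linear g → Definable (λ e → f e ≡ g e)
≡-definable p q = definable-map
  (λ e → mk⇔ (λ (f≤g , g≤f) → ℕ.≤-antisym f≤g g≤f) (λ f≡g → ℕ.≤-reflexive f≡g , ℕ.≤-reflexive (sym f≡g)))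
  (×-definable (≤-definable p q) (≤-definable q p))

-- Rows: the store of the current disjunct, the store of the
-- left-hand side, the addresses and values of the inspected cells, a scratch variable.
pattern cur = 0
pattern lhsₛ = 1
pattern adr = 2
pattern val = 3
pattern tmp = 4

pure-definable : ∀ φ → Definable (λ e → e cur ⊨ₚ φ)
pure-definable (t ≐ u) = ≡-definable (term-linear cur t) (term-linear cur u)
pure-definable (φ ∧ₚ ψ) = ×-definable (pure-definable φ) (pure-definable ψ)
pure-definable (¬ₚ φ) = ¬-definable (pure-definable φ)
pure-definable (∃ₚ x φ) = ∃-definable (cur , x) (pure-definable φ)

-- Spatial formulas

Covers : Spatial → Store → ℕ → Set
Covers emp s x = ⊥
Covers (t ↦ u) s x = x ≡ ⟦ t ⟧ₜ s
Covers (arr t u) s x = ⟦ t ⟧ₜ s ℕ.≤ x × x ℕ.≤ ⟦ u ⟧ₜ s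
Covers (σ ✶ τ) s x = Covers σ s x ⊎ Covers τ s x

-- The conditions that satisfiability by some heap puts on the store. Address 0 lies in no heap, and
-- a nonzero lower end keeps it out of a whole array.
WellFormed : Spatial → Store → Set
WellFormed emp s = ⊤
WellFormed (t ↦ u) s = ¬ ⟦ t ⟧ₜ s ≡ 0
WellFormed (arr t u) s = ⟦ t ⟧ₜ s ℕ.≤ ⟦ u ⟧ₜ s × ¬ ⟦ t ⟧ₜ s ≡ 0
WellFormed (σ ✶ τ) s =
  (WellFormed σ s × WellFormed τ s) × (∀ x → ¬ (Covers σ s x × Covers τ s x))

-- The relation is a parameter because it will stand for heap contents, for listed address-value
-- pairs, and for membership of the address in a list.
Cells : Spatial → Store → (ℕ → ℕ → Set) → Set
Cells emp s C = ⊤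
Cells (t ↦ u) s C = C (⟦ t ⟧ₜ s) (⟦ u ⟧ₜ s)
Cells (arr t u) s C = ⊤
Cells (σ ✶ τ) s C = Cells σ s C × Cells τ s C

covers? : ∀ σ s → Decidable (Covers σ s)
covers? emp s x = no λ ()
covers? (t ↦ u) s x = x ℕ.≟ ⟦ t ⟧ₜ s
covers? (arr t u) s x = (⟦ t ⟧ₜ s ℕ.≤? x) ×-dec (x ℕ.≤? ⟦ u ⟧ₜ s)
covers? (σ ✶ τ) s x = covers? σ s x ⊎-dec covers? τ s x

extent : Spatial → Store → ℕ
extent emp s = 0
extent (t ↦ u) s = suc (⟦ t ⟧ₜ s)
extent (arr t u) s = suc (⟦ u ⟧ₜ s)
extent (σ ✶ τ) s = extent σ s ℕ.+ extent τ s

covers⇒<extent : ∀ σ s {x} → Covers σ s x → x ℕ.< extent σ s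
covers⇒<extent (t ↦ u) s refl = ℕ.≤-refl
covers⇒<extent (arr t u) s (_ , x≤u) = s≤s x≤u
covers⇒<extent (σ ✶ τ) s (inj₁ c) = ℕ.≤-trans (covers⇒<extent σ s c) (ℕ.m≤m+n _ _)
covers⇒<extent (σ ✶ τ) s (inj₂ c) = ℕ.≤-trans (covers⇒<extent τ s c) (ℕ.m≤n+m _ (extent σ s))

wellFormed⇒0-uncovered : ∀ σ s → WellFormed σ s → ¬ Covers σ s 0
wellFormed⇒0-uncovered (t ↦ u) s t≢0 0≡t = t≢0 (sym 0≡t)
wellFormed⇒0-uncovered (arr t u) s (_ , t≢0) (t≤0 , _) = t≢0 (ℕ.n≤0⇒n≡0 t≤0)
wellFormed⇒0-uncovered (σ ✶ τ) s ((wσ , wτ) , _) =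
  Sum.[ wellFormed⇒0-uncovered σ s wσ , wellFormed⇒0-uncovered τ s wτ ]

cells-zipWith : ∀ σ s {C C′ C″ : ℕ → ℕ → Set} →
  (∀ {a v} → Covers σ s a → C a v → C′ a v → C″ a v) →
  Cells σ s C → Cells σ s C′ → Cells σ s C″
cells-zipWith emp s f c c′ = tt
cells-zipWith (t ↦ u) s f c c′ = f refl c c′
cells-zipWith (arr t u) s f c c′ = tt
cells-zipWith (σ ✶ τ) s f (c , d) (c′ , d′) =
  cells-zipWith σ s (f ∘ inj₁) c c′ , cells-zipWith τ s (f ∘ inj₂) d d′

cells-map : ∀ σ s {C C′ : ℕ → ℕ → Set} →
  (∀ {a v} → Covers σ s a → C a v → C′ a v) → Cells σ s C → Cells σ s C′
cells-map σ s f c = cells-zipWith σ s (λ cov c _ → f cov c) c c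

-- Satisfaction without subheaps: the store alone determines how a heap splits along `✶`, and heap
-- contents enter through `Cells` only.
Describes : Spatial → Store → Heap → Set
Describes σ s h = WellFormed σ s × (∀ x → x ∈Dom h ⇔ Covers σ s x) ×
  Cells σ s (λ a v → fun h a ≡ just v)

0∉Dom : ∀ h → ¬ (0 ∈Dom h)
0∉Dom h (v , eq) with trans (sym (zero∉ h)) eq
... | ()

module _ (h h₁ h₂ : Heap) (h≡h₁⊎h₂ : DisjUnion h h₁ h₂) where

  disjUnion-left : ∀ {x v} → fun h₁ x ≡ just v → fun h x ≡ just v
  disjUnion-left {x} eq with h≡h₁⊎h₂ x
  ... | inj₁ (h₁x , _) with trans (sym h₁x) eq
  ...   | ()
  disjUnion-left {x} eq | inj₂ (_ , hx) = trans hx eq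

  disjUnion-right : ∀ {x v} → fun h₂ x ≡ just v → fun h x ≡ just v
  disjUnion-right {x} eq with h≡h₁⊎h₂ x
  ... | inj₁ (_ , hx) = trans hx eq
  ... | inj₂ (h₂x , _) with trans (sym h₂x) eq
  ...   | ()

  disjUnion-dom : ∀ x → x ∈Dom h ⇔ (x ∈Dom h₁ ⊎ x ∈Dom h₂)
  disjUnion-dom x = mk⇔ split
    Sum.[ (λ (v , eq) → v , disjUnion-left eq) , (λ (v , eq) → v , disjUnion-right eq) ]
    where
    split : x ∈Dom h → x ∈Dom h₁ ⊎ x ∈Dom h₂
    split (v , eq) with h≡h₁⊎h₂ x
    ... | inj₁ (_ , hx) = inj₂ (v , trans (sym hx) eq)
    ... | inj₂ (_ , hx) = inj₁ (v , trans (sym hx) eq)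

  disjUnion-disjoint : ∀ {x} → x ∈Dom h₁ → ¬ (x ∈Dom h₂)
  disjUnion-disjoint {x} (v , p) (w , q) with h≡h₁⊎h₂ x
  ... | inj₁ (h₁x , _) with trans (sym h₁x) p
  ...   | ()
  disjUnion-disjoint {x} (v , p) (w , q) | inj₂ (h₂x , _) with trans (sym h₂x) q
  ...   | ()

sat⇒describes : ∀ σ s h → Sat s h σ → Describes σ s h
sat⇒describes emp s h empty = tt , (λ x → mk⇔ (empty x) λ ()) , tt
sat⇒describes (t ↦ u) s h (dom , eq) =
  (λ t≡0 → 0∉Dom h (proj₂ (dom 0) (sym t≡0))) , (λ x → mk⇔ (proj₁ (dom x)) (proj₂ (dom x))) , eq
sat⇒describes (arr t u) s h (t≤u , dom) =
  (t≤u , λ t≡0 → 0∉Dom h (proj₂ (dom 0) (ℕ.≤-reflexive t≡0 , z≤n))) ,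
  (λ x → mk⇔ (proj₁ (dom x)) (proj₂ (dom x))) , tt
sat⇒describes (σ ✶ τ) s h (h₁ , h₂ , h≡ , p , q)
  with sat⇒describes σ s h₁ p | sat⇒describes τ s h₂ q
... | wσ , dσ , cσ | wτ , dτ , cτ =
  ((wσ , wτ) , λ x (a , b) → disjUnion-disjoint h h₁ h₂ h≡ (from (dσ x) a) (from (dτ x) b)) ,
  (λ x → (dσ x ⊎-⇔ dτ x) ⇔-∘ disjUnion-dom h h₁ h₂ h≡ x) ,
  cells-map σ s (λ _ → disjUnion-left h h₁ h₂ h≡) cσ ,
  cells-map τ s (λ _ → disjUnion-right h h₁ h₂ h≡) cτ

module _ (h : Heap) {P : ℕ → Set} (P? : Decidable P) where

  restrict-fun : ℕ → Maybe ℕ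
  restrict-fun x with P? x
  ... | yes _ = fun h x
  ... | no _ = nothing

  restrict-yes : ∀ {x} → P x → restrict-fun x ≡ fun h x
  restrict-yes {x} p with P? x
  ... | yes _ = refl
  ... | no ¬p = contradiction p ¬p

  restrict-no : ∀ {x} → ¬ P x → restrict-fun x ≡ nothing
  restrict-no {x} ¬p with P? x
  ... | yes p = contradiction p ¬p
  ... | no _ = refl

  restrict-nothing : ∀ {x} → fun h x ≡ nothing → restrict-fun x ≡ nothing
  restrict-nothing {x} eq with P? x
  ... | yes _ = eq
  ... | no _ = refl

  restrict-just : ∀ {x v} → restrict-fun x ≡ just v → P x
  restrict-just {x} eq with P? x | eq
  ... | yes p | _ = p
  ... | no _ | ()

  restrict : Heap
  restrict = record
    { fun = restrict-fun
    ; zero∉ = restrict-nothing (zero∉ h)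
    ; finite = let b , above = finite h in b , λ x b≤x → restrict-nothing (above x b≤x)
    }

-- The two subheaps for `✶` are the restrictions of `h` to the addresses covered by each side.
describes⇒sat : ∀ σ s h → Describes σ s h → Sat s h σ
describes⇒sat emp s h (_ , dom , _) x = to (dom x)
describes⇒sat (t ↦ u) s h (_ , dom , eq) = (λ x → to (dom x) , from (dom x)) , eq
describes⇒sat (arr t u) s h ((t≤u , _) , dom , _) = t≤u , λ x → to (dom x) , from (dom x)
describes⇒sat (σ ✶ τ) s h (((wσ , wτ) , disj) , dom , cσ , cτ) =
  restrict h (covers? σ s) , restrict h (covers? τ s) , union ,
  describes⇒sat σ s _ (wσ , domain σ inj₁ ,
    cells-map σ s (λ c → trans (restrict-yes h (covers? σ s) c)) cσ) ,
  describes⇒sat τ s _ (wτ , domain τ inj₂ ,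
    cells-map τ s (λ c → trans (restrict-yes h (covers? τ s) c)) cτ)
  where
  domain : ∀ ρ → (∀ {x} → Covers ρ s x → Covers (σ ✶ τ) s x) →
    ∀ x → x ∈Dom restrict h (covers? ρ s) ⇔ Covers ρ s x
  domain ρ inj x = mk⇔ (λ (v , eq) → restrict-just h (covers? ρ s) eq)
    (λ c → let v , eq = from (dom x) (inj c) in v , trans (restrict-yes h (covers? ρ s) c) eq)

  union : DisjUnion h (restrict h (covers? σ s)) (restrict h (covers? τ s))
  union x with covers? σ s x
  ... | yes c = inj₂ (restrict-no h (covers? τ s) (λ c′ → disj x (c , c′)) , refl)
  ... | no ¬c with covers? τ s x
  ...   | yes _ = inj₁ (refl , refl)
  ...   | no ¬c′ with fun h x in eq
  ...     | just v = contradiction (to (dom x) (v , eq)) Sum.[ ¬c , ¬c′ ]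
  ...     | nothing = inj₁ (refl , refl)

-- Definability of domains and cells.

covers-definable : ∀ i {f} → Linear f → ∀ σ → Definable (λ e → Covers σ (e i) (f e))
covers-definable i f emp = ⊥-definable
covers-definable i f (t ↦ u) = ≡-definable f (term-linear i t)
covers-definable i f (arr t u) =
  ×-definable (≤-definable (term-linear i t) f) (≤-definable f (term-linear i u))
covers-definable i f (σ ✶ τ) = ⊎-definable (covers-definable i f σ) (covers-definable i f τ)

wellFormed-definable : ∀ σ → Definable (λ e → WellFormed σ (e cur))
wellFormed-definable emp = ⊤-definable
wellFormed-definable (t ↦ u) = ¬-definable (≡-definable (term-linear cur t) (const-linear 0))
wellFormed-definable (arr t u) = ×-definable (≤-definable (term-linear cur t) (term-linear cur u))
  (¬-definable (≡-definable (term-linear cur t) (const-linear 0)))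
wellFormed-definable (σ ✶ τ) = ×-definable (×-definable (wellFormed-definable σ) (wellFormed-definable τ))
  (∀-definable (tmp , 0) (¬-definable (×-definable (covered σ) (covered τ))))
  where
  covered : ∀ ρ → Definable (λ e → Covers ρ (e cur) (e tmp 0))
  covered = covers-definable cur (slot-linear (tmp , 0))

cells-definable : ∀ i {C : Env → ℕ → ℕ → Set} →
  (∀ t u → Definable (λ e → C e (⟦ t ⟧ₜ (e i)) (⟦ u ⟧ₜ (e i)))) →
  ∀ σ → Definable (λ e → Cells σ (e i) (C e))
cells-definable i c emp = ⊤-definable
cells-definable i c (t ↦ u) = c t u
cells-definable i c (arr t u) = ⊤-definable
cells-definable i c (σ ✶ τ) = ×-definable (cells-definable i c σ) (cells-definable i c τ)

-- Since a model of the left-hand side has the set covered by `σ` as its domain, the domain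
-- condition of a disjunct becomes a relation between two stores.
SameDomain : Spatial → Store → Spatial → Store → Set
SameDomain σ s τ s′ = ∀ x → Covers σ s x ⇔ Covers τ s′ x

sameDomain-definable : ∀ σ τ → Definable (λ e → SameDomain σ (e lhsₛ) τ (e cur))
sameDomain-definable σ τ = ∀-definable (tmp , 0)
  (⇔-definable (covers-definable lhsₛ scratch σ) (covers-definable cur scratch τ))
  where
  scratch : Linear (λ e → e tmp 0)
  scratch = slot-linear (tmp , 0)

-- Blocks of bound variables.

Exists : List Var → (Store → Set) → Store → Set
Exists [] K s = K s
Exists (y ∷ ys) K s = ∃ λ n → Exists ys K (s [ y ≔ n ])

Forall : List Var → (Store → Set) → Store → Set
Forall [] K s = K s
Forall (y ∷ ys) K s = ∀ n → Forall ys K (s [ y ≔ n ])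

-- Passing the other rows to `K` separately lets an update of `cur` reduce to an update of its last
-- argument alone.
exists-definable : ∀ ys {K : Store → Store → Store → Store → Set} →
  Definable (λ e → K (e lhsₛ) (e adr) (e val) (e cur)) →
  Definable (λ e → Exists ys (K (e lhsₛ) (e adr) (e val)) (e cur))
exists-definable [] k = k
exists-definable (y ∷ ys) {K} k = ∃-definable (cur , y) (exists-definable ys {K} k)

forall-definable : ∀ ys {K : Store → Store → Store → Set} →
  Definable (λ e → K (e lhsₛ) (e adr) (e cur)) →
  Definable (λ e → Forall ys (K (e lhsₛ) (e adr)) (e cur))
forall-definable [] k = k
forall-definable (y ∷ ys) {K} k = ∀-definable (cur , y) (forall-definable ys {K} k)

exists-zipWith : ∀ ys {K L M : Store → Set} s → (∀ s′ → K s′ → L s′ → M s′) →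
  Forall ys K s → Exists ys L s → Exists ys M s
exists-zipWith [] s f k l = f s k l
exists-zipWith (y ∷ ys) s f k (n , l) = n , exists-zipWith ys (s [ y ≔ n ]) f (k n) l

AgreeOff : List Var → Store → Store → Set
AgreeOff ys s s′ = ∀ x → x ∉ ys → s′ x ≡ s x

forall-intro : ∀ ys {K : Store → Set} s → (∀ s′ → AgreeOff ys s s′ → K s′) → Forall ys K s
forall-intro [] s f = f s (λ _ _ → refl)
forall-intro (y ∷ ys) s f n = forall-intro ys (s [ y ≔ n ]) λ s′ agree →
  f s′ λ x x∉ → trans (agree x (x∉ ∘ there)) (store-other s (x∉ ∘ here))

exists-map : ∀ ys {K L : Store → Set} s → (∀ s′ → K s′ → L s′) → Exists ys K s → Exists ys L s
exists-map ys s f = exists-zipWith ys s (λ s′ _ → f s′) (forall-intro ys {λ _ → ⊤} s λ _ _ → tt)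

satEx⇔exists : ∀ s h ys φ → SatEx s h ys φ ⇔ Exists ys (λ s′ → s′ , h ⊨ φ) s
satEx⇔exists s h [] φ = ⇔-id _
satEx⇔exists s h (y ∷ ys) φ = mk⇔
  (λ (n , p) → n , to (satEx⇔exists (s [ y ≔ n ]) h ys φ) p)
  (λ (n , p) → n , from (satEx⇔exists (s [ y ≔ n ]) h ys φ) p)

anySat⇔any : ∀ s h ds → AnySat s h ds ⇔ Any (λ d → SatEx s h (bound d) (body d)) ds
anySat⇔any s h [] = mk⇔ (λ ()) (λ ())
anySat⇔any s h (d ∷ ds) = mk⇔
  Sum.[ here , there ∘ to (anySat⇔any s h ds) ]
  (λ { (here p) → inj₁ p ; (there p) → inj₂ (from (anySat⇔any s h ds) p) })

-- Tilings by intervals.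

-- (a , l) stands for the interval [a , a + l].
Interval : Set
Interval = ℕ × ℕ

Within : Interval → ℕ → Set
Within (a , l) x = a ℕ.≤ x × x ℕ.≤ a ℕ.+ l

within? : ∀ p → Decidable (Within p)
within? (a , l) x = (a ℕ.≤? x) ×-dec (x ℕ.≤? a ℕ.+ l)

within-start : ∀ p → Within p (proj₁ p)
within-start (a , l) = ℕ.≤-refl , ℕ.m≤m+n a l

intervals : Spatial → Store → List Interval
intervals emp s = []
intervals (t ↦ u) s = (⟦ t ⟧ₜ s , 0) ∷ []
intervals (arr t u) s = (⟦ t ⟧ₜ s , ⟦ u ⟧ₜ s ℕ.∸ ⟦ t ⟧ₜ s) ∷ []
intervals (σ ✶ τ) s = intervals σ s ++ intervals τ s

starts : Spatial → Store → List ℕ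
starts σ s = map proj₁ (intervals σ s)

sizes : Spatial → Store → List ℕ
sizes σ s = map proj₂ (intervals σ s)

count : Spatial → ℕ
count emp = 0
count (t ↦ u) = 1
count (arr t u) = 1
count (σ ✶ τ) = count σ ℕ.+ count τ

intervals-length : ∀ σ s → length (intervals σ s) ≡ count σ
intervals-length emp s = refl
intervals-length (t ↦ u) s = refl
intervals-length (arr t u) s = refl
intervals-length (σ ✶ τ) s = trans (length-++ (intervals σ s))
  (cong₂ ℕ._+_ (intervals-length σ s) (intervals-length τ s))

-- Well-formedness matters for arrays: with inverted bounds nothing is covered, but truncated
-- subtraction would yield a one-point interval.
covers⇔within : ∀ σ s → WellFormed σ s → ∀ x → Covers σ s x ⇔ Any (λ p → Within p x) (intervals σ s)
covers⇔within emp s w x = mk⇔ (λ ()) (λ ())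
covers⇔within (t ↦ u) s w x = mk⇔
  (λ { refl → here (within-start (⟦ t ⟧ₜ s , 0)) })
  (λ { (here (t≤x , x≤t)) → ℕ.≤-antisym (subst (x ℕ.≤_) (ℕ.+-identityʳ _) x≤t) t≤x })
covers⇔within (arr t u) s (t≤u , _) x = mk⇔
  (λ (t≤x , x≤u) → here (t≤x , subst (x ℕ.≤_) (sym (ℕ.m+[n∸m]≡n t≤u)) x≤u))
  (λ { (here (t≤x , x≤u)) → t≤x , subst (x ℕ.≤_) (ℕ.m+[n∸m]≡n t≤u) x≤u })
covers⇔within (σ ✶ τ) s ((wσ , wτ) , _) x = mk⇔
  Sum.[ Any.++⁺ˡ ∘ to (covers⇔within σ s wσ x) , Any.++⁺ʳ (intervals σ s) ∘ to (covers⇔within τ s wτ x) ]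
  (Sum.map (from (covers⇔within σ s wσ x)) (from (covers⇔within τ s wτ x)) ∘ Any.++⁻ (intervals σ s))

-- Allowing equal overlapping intervals makes this property stable under sublists.
Separated : List Interval → Set
Separated ps = ∀ {p q x} → p ∈ ps → q ∈ ps → Within p x → Within q x → p ≡ q

intervals-separated : ∀ σ s → WellFormed σ s → Separated (intervals σ s)
intervals-separated emp s w ()
intervals-separated (t ↦ u) s w (here refl) (here refl) _ _ = refl
intervals-separated (arr t u) s w (here refl) (here refl) _ _ = refl
intervals-separated (σ ✶ τ) s ((wσ , wτ) , disj) {x = x} p∈ q∈ p∋x q∋x
  with Any.++⁻ (intervals σ s) p∈ | Any.++⁻ (intervals σ s) q∈
... | inj₁ p∈σ | inj₁ q∈σ = intervals-separated σ s wσ p∈σ q∈σ p∋x q∋x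
... | inj₂ p∈τ | inj₂ q∈τ = intervals-separated τ s wτ p∈τ q∈τ p∋x q∋x
... | inj₁ p∈σ | inj₂ q∈τ = contradiction
  (from (covers⇔within σ s wσ x) (lose p∈σ p∋x) , from (covers⇔within τ s wτ x) (lose q∈τ q∋x)) (disj x)
... | inj₂ p∈τ | inj₁ q∈σ = contradiction
  (from (covers⇔within σ s wσ x) (lose q∈σ q∋x) , from (covers⇔within τ s wτ x) (lose p∈τ p∋x)) (disj x)

-- A points-to tile has a single point, so bounding the possible starts bounds the possible
-- addresses of `↦`-atoms.
cells-start : ∀ σ s → Cells σ s (λ a _ → a ∈ starts σ s)
cells-start emp s = tt
cells-start (t ↦ u) s = here refl
cells-start (arr t u) s = tt
cells-start (σ ✶ τ) s rewrite map-++ proj₁ (intervals σ s) (intervals τ s) =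
  cells-map σ s (λ _ → Any.++⁺ˡ) (cells-start σ s) ,
  cells-map τ s (λ _ → Any.++⁺ʳ (starts σ s)) (cells-start τ s)

term-cong : ∀ t {s s′} → (∀ x → x occursIn t → s′ x ≡ s x) → ⟦ t ⟧ₜ s′ ≡ ⟦ t ⟧ₜ s
term-cong (var x) eq = eq x refl
term-cong (lit n) eq = refl
term-cong (t ⊕ u) eq = cong₂ ℕ._+_ (term-cong t λ x → eq x ∘ inj₁) (term-cong u λ x → eq x ∘ inj₂)

-- The restriction on arrays enters here: the size of `arr t (t ⊕ u)` is the value of `u`, which the
-- bound variables cannot change.
sizes-fixed : ∀ ys σ → ArrOK ys σ → ∀ s s′ → AgreeOff ys s s′ → sizes σ s′ ≡ sizes σ s
sizes-fixed ys emp ok s s′ agree = refl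
sizes-fixed ys (t ↦ u) ok s s′ agree = refl
sizes-fixed ys (arr t .(t ⊕ u)) (u , refl , u∌ys) s s′ agree = cong (_∷ [])
  (trans (ℕ.m+n∸m≡n (⟦ t ⟧ₜ s′) (⟦ u ⟧ₜ s′))
    (trans (term-cong u λ x x∈u → agree x (u∌ys x x∈u)) (sym (ℕ.m+n∸m≡n (⟦ t ⟧ₜ s) (⟦ u ⟧ₜ s)))))
sizes-fixed ys (σ ✶ τ) (okσ , okτ) s s′ agree =
  trans (map-++ proj₂ (intervals σ s′) (intervals τ s′))
    (trans (cong₂ _++_ (sizes-fixed ys σ okσ s s′ agree) (sizes-fixed ys τ okτ s s′ agree))
      (sym (map-++ proj₂ (intervals σ s) (intervals τ s))))

-- The junk value b is returned when D has no element below b.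
least : ∀ {D : ℕ → Set} → Decidable D → ℕ → ℕ
least D? zero = 0
least D? (suc b) with D? 0
... | yes _ = 0
... | no _ = suc (least (D? ∘ suc) b)

least-correct : ∀ {D : ℕ → Set} (D? : Decidable D) b {y} → D y → y ℕ.< b →
  D (least D? b) × ∀ {z} → D z → least D? b ℕ.≤ z
least-correct D? (suc b) {y} d y<b with D? 0
... | yes d₀ = d₀ , λ _ → z≤n
least-correct D? (suc b) {zero} d y<b | no ¬d₀ = contradiction d ¬d₀
least-correct {D} D? (suc b) {suc y} d (s≤s y<b) | no ¬d₀ with least-correct (D? ∘ suc) b d y<b
... | dₘ , minimal = dₘ , λ { {zero} d₀ → contradiction d₀ ¬d₀ ; {suc z} dz → s≤s (minimal dz) }

Remove : Interval → (ℕ → Set) → ℕ → Set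
Remove p D x = D x × ¬ Within p x

remove? : ∀ p {D} → Decidable D → Decidable (Remove p D)
remove? p D? x = D? x ×-dec ¬? (within? p x)

-- Whichever way D is tiled by n intervals with sizes from ls, one of them starts
-- at the least element of D, and the others tile what remains.
tileStarts : List ℕ → ℕ → ∀ {D} → Decidable D → ℕ → List ℕ
tileStarts ls zero D? b = []
tileStarts ls (suc n) D? b =
  least D? b ∷ concatMap (λ l → tileStarts ls n (remove? (least D? b , l) D?) b) ls

-- The number of candidate starts does not depend on the store, so a single formula can name them
-- all. A size remains available after use, which overcounts harmlessly.
tileCount : ℕ → ℕ → ℕ
tileCount m zero = 0
tileCount m (suc n) = suc (m ℕ.* tileCount m n)

concatMap-length : ∀ {A B : Set} (f : A → List B) {k} → (∀ x → length (f x) ≡ k) →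
  ∀ xs → length (concatMap f xs) ≡ length xs ℕ.* k
concatMap-length f eq [] = refl
concatMap-length f eq (x ∷ xs) =
  trans (length-++ (f x)) (cong₂ ℕ._+_ (eq x) (concatMap-length f eq xs))

tileStarts-length : ∀ ls n {D} (D? : Decidable D) b →
  length (tileStarts ls n D? b) ≡ tileCount (length ls) n
tileStarts-length ls zero D? b = refl
tileStarts-length ls (suc n) D? b = cong suc
  (concatMap-length _ (λ l → tileStarts-length ls n (remove? (least D? b , l) D?) b) ls)

-- The tile `q` containing the least element `m` must start at `m`, because its own start lies in
-- `D`. Any tile starting elsewhere belongs to a shorter tiling of `D` without `q`, to which
-- induction applies.
tileStarts-complete : ∀ ls n {D} (D? : Decidable D) b → (∀ {x} → D x → x ℕ.< b) →
  ∀ ps → length ps ℕ.≤ n → (∀ x → D x ⇔ Any (λ p → Within p x) ps) → Separated ps →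
  (∀ {p} → p ∈ ps → proj₂ p ∈ ls) → ∀ {p} → p ∈ ps → proj₁ p ∈ tileStarts ls n D? b
tileStarts-complete ls zero D? b D<b [] _ tiles sep sized ()
tileStarts-complete ls (suc n) {D} D? b D<b ps len tiles sep sized {p} p∈
  -- The tile `p` shows that `D` has an element below `b`, so `least D? b` is not the junk value.
  with dp ← from (tiles _) (lose p∈ (within-start p))
  with dm , minimal ← least-correct D? b dp (D<b dp)
  with find (to (tiles _) dm)
... | q@(a , l) , q∈ , q∋m with ℕ.≤-antisym (proj₁ q∋m)
      (minimal (from (tiles _) (lose q∈ (within-start q))))
...   | a≡m with proj₁ p ℕ.≟ least D? b
...     | yes p≡m = here p≡m
...     | no p≢m = there (∈-concatMap⁺ _ (Any.map (λ { refl → later }) (sized q∈)))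
  where
  m = least D? b
  -- By separation, the tiles starting at `m` are precisely the copies of `q`.
  other? = λ (r : Interval) → ¬? (proj₁ r ℕ.≟ m)
  ps′ = filter other? ps

  ps′⊆ps : ∀ {r} → r ∈ ps′ → r ∈ ps
  ps′⊆ps = proj₁ ∘ ∈-filter⁻ other?

  tiles′ : ∀ x → Remove (m , l) D x ⇔ Any (λ r → Within r x) ps′
  tiles′ x = mk⇔ forth back
    where
    forth : Remove (m , l) D x → Any (λ r → Within r x) ps′
    forth (dx , x∉q) with find (to (tiles x) dx)
    ... | r , r∈ , r∋x = lose (∈-filter⁺ other? r∈ r≢m) r∋x
      where
      r≢m : proj₁ r ≢ m
      r≢m r≡m with sep r∈ q∈ (subst (Within r) r≡m (within-start r)) q∋m
      ... | refl = x∉q (subst (λ z → Within (z , l) x) a≡m r∋x)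
    back : Any (λ r → Within r x) ps′ → Remove (m , l) D x
    back any with find any
    ... | r , r∈′ , r∋x with ∈-filter⁻ other? r∈′
    ...   | r∈ , r≢m = from (tiles x) (lose r∈ r∋x) , λ x∈m → r≢m
      (trans (cong proj₁ (sep r∈ q∈ r∋x (subst (λ z → Within (z , l) x) (sym a≡m) x∈m))) a≡m)

  later : proj₁ p ∈ tileStarts ls n (remove? (m , l) D?) b
  later = tileStarts-complete ls n (remove? (m , l) D?) b (D<b ∘ proj₁) ps′
    (ℕ.≤-pred (ℕ.≤-trans (filter-notAll other? ps (lose q∈ λ a≢m → a≢m a≡m)) len))
    tiles′ (λ r∈ r′∈ → sep (ps′⊆ps r∈) (ps′⊆ps r′∈)) (sized ∘ ps′⊆ps) (∈-filter⁺ other? p∈ p≢m)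

starts-complete : ∀ σ s ls {D} (D? : Decidable D) b → (∀ {x} → D x → x ℕ.< b) →
  WellFormed σ s → (∀ x → D x ⇔ Covers σ s x) → sizes σ s ≡ ls →
  Cells σ s (λ a _ → a ∈ tileStarts ls (count σ) D? b)
starts-complete σ s ls D? b D<b w dom refl = cells-map σ s (λ _ → found) (cells-start σ s)
  where
  found : ∀ {a} → a ∈ starts σ s → a ∈ tileStarts ls (count σ) D? b
  found a∈ with find (Any.map⁻ a∈)
  ... | p , p∈ , refl = tileStarts-complete ls (count σ) D? b D<b (intervals σ s)
    (ℕ.≤-reflexive (intervals-length σ s)) (λ x → covers⇔within σ s w x ⇔-∘ dom x)
    (intervals-separated σ s w) (∈-map⁺ proj₂) p∈

-- Turns a list into a row of an environment. The default 0 is harmless, as only indices below the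
-- length will be read.
nth : List ℕ → ℕ → ℕ
nth [] k = 0
nth (x ∷ xs) zero = x
nth (x ∷ xs) (suc k) = nth xs k

∈⇒nth : ∀ {x xs} → x ∈ xs → ∃ λ k → k ℕ.< length xs × nth xs k ≡ x
∈⇒nth (here refl) = 0 , s≤s z≤n , refl
∈⇒nth (there x∈) with ∈⇒nth x∈
... | k , k< , eq = suc k , s≤s k< , eq

-- Encoding of validity as a Presburger query.

module Encoding (π : Pure) (σ : Spatial) (ds : List ExSymHeap) where

  disjunctTiles : ExSymHeap → ℕ
  disjunctTiles d = let n = count (SymHeap.spatial (body d)) in tileCount n n

  m : ℕ
  m = count σ ℕ.+ sum (map disjunctTiles ds)

  Inspected : Store → ℕ → Set
  Inspected A a = Any (λ k → A k ≡ a) (upTo m)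

  Listed : Store → Store → ℕ → ℕ → Set
  Listed A W a v = Any (λ k → A k ≡ a × W k ≡ v) (upTo m)

  -- An address may be listed several times; its values must then coincide.
  Functional : Store → Store → Set
  Functional A W = All (λ k → All (λ l → A k ≡ A l → W k ≡ W l) (upTo m)) (upTo m)

  -- The formula never computes `tileStarts`. It assumes that the row `A` misses no `↦`-address of
  -- an instance with the right domain; tilings only serve to show that such a row of length `m`
  -- exists.
  Adequate : Store → Store → ExSymHeap → Set
  Adequate s A (∃[ ys ] (_ ∧ τ)) = Forall ys
    (λ s′ → WellFormed τ s′ × SameDomain σ s τ s′ → Cells τ s′ (λ a _ → Inspected A a)) s

  Matches : Store → Store → Store → ExSymHeap → Set
  Matches s A W (∃[ ys ] (φ ∧ τ)) = Exists ys
    (λ s′ → s′ ⊨ₚ φ × (WellFormed τ s′ × SameDomain σ s τ s′) × Cells τ s′ (Listed A W)) s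

  Premise : Store → Store → Store → Set
  Premise s A W = ((s ⊨ₚ π × WellFormed σ s) × Cells σ s (Listed A W)) ×
    Functional A W × All (Adequate s A) ds

  Query : Env → Set
  Query e = Premise (e lhsₛ) (e adr) (e val) → Any (Matches (e lhsₛ) (e adr) (e val)) ds

  inspected-definable : ∀ {f} → Linear f → Definable (λ e → Inspected (e adr) (f e))
  inspected-definable f = any-definable (λ k → ≡-definable (slot-linear (adr , k)) f) (upTo m)

  listed-definable : ∀ {f g} → Linear f → Linear g → Definable (λ e → Listed (e adr) (e val) (f e) (g e))
  listed-definable f g = any-definable
    (λ k → ×-definable (≡-definable (slot-linear (adr , k)) f)
                       (≡-definable (slot-linear (val , k)) g)) (upTo m)

  functional-definable : Definable (λ e → Functional (e adr) (e val))
  functional-definable = all-definable (λ k → all-definable (λ l → →-definable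
    (≡-definable (slot-linear (adr , k)) (slot-linear (adr , l)))
    (≡-definable (slot-linear (val , k)) (slot-linear (val , l)))) (upTo m)) (upTo m)

  -- Lets the bound variables of a disjunct be updated starting from the left-hand store.
  initial : ℕ → ℕ
  initial cur = lhsₛ
  initial i = i

  adequate-definable : ∀ d → Definable (λ e → Adequate (e lhsₛ) (e adr) d)
  adequate-definable (∃[ ys ] (_ ∧ τ)) = rename-definable initial (forall-definable ys
    {λ s A s′ → WellFormed τ s′ × SameDomain σ s τ s′ → Cells τ s′ (λ a _ → Inspected A a)}
    (→-definable (×-definable (wellFormed-definable τ) (sameDomain-definable σ τ))
      (cells-definable cur (λ t u → inspected-definable (term-linear cur t)) τ)))

  matches-definable : ∀ d → Definable (λ e → Matches (e lhsₛ) (e adr) (e val) d)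
  matches-definable (∃[ ys ] (φ ∧ τ)) = rename-definable initial (exists-definable ys
    {λ s A W s′ → s′ ⊨ₚ φ × (WellFormed τ s′ × SameDomain σ s τ s′) × Cells τ s′ (Listed A W)}
    (×-definable (pure-definable φ) (×-definable
      (×-definable (wellFormed-definable τ) (sameDomain-definable σ τ))
      (cells-definable cur (λ t u → listed-definable (term-linear cur t) (term-linear cur u)) τ))))

  query-definable : Definable Query
  query-definable = →-definable
    (×-definable
      (×-definable
        (×-definable (rename-definable (λ _ → lhsₛ) (pure-definable π))
                     (rename-definable (λ _ → lhsₛ) (wellFormed-definable σ)))
        (cells-definable lhsₛ (λ t u → listed-definable (term-linear lhsₛ t) (term-linear lhsₛ u)) σ))
      (×-definable functional-definable (all-definable adequate-definable ds)))
    (any-definable matches-definable ds)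

  entailment : Entailment
  entailment = record { lhs = π ∧ σ ; rhs = ds }

  -- Unlisted cells receive the arbitrary value 0. Under `Adequate`, no `↦`-atom of a disjunct with
  -- this domain looks at them.
  module HeapOfLists (s A W : Store) (wf : WellFormed σ s) where

    content : ℕ → ℕ
    content x with Any.any? (λ k → A k ℕ.≟ x) (upTo m)
    ... | yes p = W (proj₁ (find p))
    ... | no _ = 0

    -- `content` reads the value at whichever index the search returns; functionality makes that
    -- choice immaterial.
    content-listed : Functional A W → ∀ {a v} → Listed A W a v → content a ≡ v
    content-listed functional {a} listed with Any.any? (λ k → A k ℕ.≟ a) (upTo m) | find listed
    ... | no ¬p | k , k∈ , eq , _ = contradiction (lose k∈ eq) ¬p
    ... | yes p | k , k∈ , eq , refl =
      let l , l∈ , eq′ = find p in All.lookup (All.lookup functional l∈) k∈ (trans eq′ (sym eq))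

    cell : ℕ → Maybe ℕ
    cell x with covers? σ s x
    ... | yes _ = just (content x)
    ... | no _ = nothing

    cell-covered : ∀ {x} → Covers σ s x → cell x ≡ just (content x)
    cell-covered {x} c with covers? σ s x
    ... | yes _ = refl
    ... | no ¬c = contradiction c ¬c

    cell-uncovered : ∀ {x} → ¬ Covers σ s x → cell x ≡ nothing
    cell-uncovered {x} ¬c with covers? σ s x
    ... | yes c = contradiction c ¬c
    ... | no _ = refl

    cell-just : ∀ {x v} → cell x ≡ just v → Covers σ s x
    cell-just {x} eq with covers? σ s x | eq
    ... | yes c | _ = c
    ... | no _ | ()

    heap : Heap
    heap = record
      { fun = cell
      ; zero∉ = cell-uncovered (wellFormed⇒0-uncovered σ s wf)
      ; finite = extent σ s , λ x b≤x → cell-uncovered λ c → ℕ.<⇒≱ (covers⇒<extent σ s c) b≤x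
      }

    heap-dom : ∀ x → x ∈Dom heap ⇔ Covers σ s x
    heap-dom x = mk⇔ (λ (v , eq) → cell-just eq) (λ c → content x , cell-covered c)

  -- Validity is applied to the heap built from the lists. The disjunct obtained has the domain of
  -- `σ`, so adequacy places its `↦`-addresses among the listed ones, with the heap's values.
  valid⇒query : Valid entailment → ∀ e → Query e
  valid⇒query valid e (((sπ , wf) , listed) , functional , adequate)
    with find (to (anySat⇔any s heap ds) (valid s heap (sπ , describes⇒sat σ s heap
      (wf , heap-dom , cells-map σ s
        (λ c l → trans (cell-covered c) (cong just (content-listed functional l))) listed))))
    where
    s = e lhsₛ
    open HeapOfLists s (e adr) (e val) wf
  ... | d@(∃[ ys ] (φ ∧ τ)) , d∈ , sat = lose d∈
    (exists-zipWith ys s matches (All.lookup adequate d∈) (to (satEx⇔exists s heap ys (φ ∧ τ)) sat))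
    where
    s = e lhsₛ
    A = e adr
    W = e val
    open HeapOfLists s A W wf
    matches : ∀ s′ →
      (WellFormed τ s′ × SameDomain σ s τ s′ → Cells τ s′ (λ a _ → Inspected A a)) →
      s′ , heap ⊨ (φ ∧ τ) →
      s′ ⊨ₚ φ × (WellFormed τ s′ × SameDomain σ s τ s′) × Cells τ s′ (Listed A W)
    matches s′ covered (s′φ , s′τ) with sat⇒describes τ s′ heap s′τ
    ... | wτ , dom , cells = s′φ , shape , cells-zipWith τ s′ list (covered shape) cells
      where
      shape : WellFormed τ s′ × SameDomain σ s τ s′
      shape = wτ , λ x → dom x ⇔-∘ ⇔-sym (heap-dom x)
      list : ∀ {a v} → Covers τ s′ a → Inspected A a → cell a ≡ just v → Listed A W a v
      list {a} {v} c inspected eq = Any.map (λ A≡a → proj₁ A≡a , trans (proj₂ A≡a) content≡v) named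
        where
        content≡v : content a ≡ v
        content≡v = just-injective (trans (sym (cell-covered (cell-just eq))) eq)
        named : Any (λ k → A k ≡ a × W k ≡ content a) (upTo m)
        named with find inspected
        ... | k , k∈ , A≡a = lose k∈ (A≡a , sym (content-listed functional (lose k∈ (A≡a , refl))))

  module ListsOfHeap (s : Store) (h : Heap) where

    disjunctStarts : ExSymHeap → List ℕ
    disjunctStarts (∃[ _ ] (_ ∧ τ)) = tileStarts (sizes τ s) (count τ) (covers? σ s) (extent σ s)

    addresses : List ℕ
    addresses = starts σ s ++ concatMap disjunctStarts ds

    disjunctStarts-length : ∀ d → length (disjunctStarts d) ≡ disjunctTiles d
    disjunctStarts-length (∃[ _ ] (_ ∧ τ)) =
      trans (tileStarts-length (sizes τ s) (count τ) (covers? σ s) (extent σ s))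
        (cong (λ n → tileCount n (count τ)) (trans (length-map proj₂ (intervals τ s)) (intervals-length τ s)))

    addresses-length : length addresses ≡ m
    addresses-length = trans (length-++ (starts σ s))
      (cong₂ ℕ._+_ (trans (length-map proj₁ (intervals σ s)) (intervals-length σ s)) (total ds))
      where
      total : ∀ ds → length (concatMap disjunctStarts ds) ≡ sum (map disjunctTiles ds)
      total [] = refl
      total (d ∷ ds) = trans (length-++ (disjunctStarts d)) (cong₂ ℕ._+_ (disjunctStarts-length d) (total ds))

    A W : Store
    A = nth addresses
    -- Outside the domain the value 0 is a dummy: listed pairs are compared with the heap only at
    -- addresses of its domain.
    W k = fromMaybe 0 (fun h (A k))

    inspected : ∀ {a} → a ∈ addresses → Inspected A a
    inspected a∈ with ∈⇒nth a∈
    ... | k , k< , eq = lose (∈-upTo⁺ (subst (k ℕ.<_) addresses-length k<)) eq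

    stored⇒listed : ∀ {a v} → a ∈ addresses → fun h a ≡ just v → Listed A W a v
    stored⇒listed a∈ eq = Any.map (λ { refl → refl , cong (fromMaybe 0) eq }) (inspected a∈)

    listed⇒stored : ∀ {a v} → a ∈Dom h → Listed A W a v → fun h a ≡ just v
    listed⇒stored (w , eq) listed with Any.satisfied listed
    ... | k , refl , refl = trans eq (cong just (sym (cong (fromMaybe 0) eq)))

    functional : Functional A W
    functional = All.tabulate λ _ → All.tabulate λ _ eq → cong (fromMaybe 0 ∘ fun h) eq

    -- Whatever the bound variables are, the tile sizes are those computed at `s`, so one list of
    -- starts serves all instances of a disjunct.
    adequate : All (λ d → ArrOK (bound d) (SymHeap.spatial (body d))) ds → All (Adequate s A) ds
    adequate oks = All.tabulate λ {d} d∈ → lemma d d∈ (All.lookup oks d∈)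
      where
      lemma : ∀ d → d ∈ ds → ArrOK (bound d) (SymHeap.spatial (body d)) → Adequate s A d
      lemma (∃[ ys ] (_ ∧ τ)) d∈ ok = forall-intro ys s λ s′ agree (wτ , dom) →
        cells-map τ s′ (λ _ a∈ → inspected (Any.++⁺ʳ (starts σ s) (∈-concatMap⁺ disjunctStarts (lose d∈ a∈))))
          (starts-complete τ s′ (sizes τ s) (covers? σ s) (extent σ s) (covers⇒<extent σ s) wτ dom
            (sizes-fixed ys τ ok s s′ agree))

  -- The query is applied to rows read off the given heap. A matching disjunct has the domain of
  -- `h`, and its listed cells carry the contents of `h`, so it is satisfied by `h` itself.
  query⇒valid : Restricted entailment → (∀ e → Query e) → Valid entailment
  query⇒valid oks query s h (sπ , sσ) with sat⇒describes σ s h sσ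
  ... | wσ , dom , cells = from (anySat⇔any s h ds) (Any.map matches⇒sat (query env premise))
    where
    open ListsOfHeap s h

    env : Env
    env lhsₛ = s
    env adr = A
    env val = W
    env _ = s

    premise : Premise s A W
    premise = ((sπ , wσ) ,
        cells-zipWith σ s (λ _ a∈ → stored⇒listed (Any.++⁺ˡ a∈)) (cells-start σ s) cells) ,
      functional , adequate oks

    matches⇒sat : ∀ {d} → Matches s A W d → SatEx s h (bound d) (body d)
    matches⇒sat {∃[ ys ] (φ ∧ τ)} matches = from (satEx⇔exists s h ys (φ ∧ τ))
      (exists-map ys s (λ s′ (s′φ , (wτ , same) , listed) → s′φ , describes⇒sat τ s′ h
        (wτ , (λ x → same x ⇔-∘ dom x) ,
          cells-map τ s′ (λ {a} c → listed⇒stored (from (dom a) (from (same a) c))) listed)) matches)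

theorem3p4 : (e : Entailment) → Restricted e → Dec (Valid e)
theorem3p4 record { lhs = π ∧ σ ; rhs = ds } restricted =
  Dec.map′ (query⇒valid restricted) valid⇒query (presburger-decidable query-definable)
  where open Encoding π σ ds
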